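{- There exists a residuated lattice $A$ that does not satisfy the identity $\neg a\vee\neg\neg a=1$ for all $a\in A$, but whose reticulation $\mathcal{L}(A)$ is a pseudocomplemented lattice satisfying $l^{*}\vee l^{**}=1$ for all $l\in\mathcal{L}(A)$.
   Context: A residuated lattice is an algebra $(A,\vee,\wedge,\odot,\rightarrow,0,1)$ such that $(A,\vee,\wedge,0,1)$ is a bounded lattice, $(A,\odot,1)$ is a commutative monoid, and $a\leq b\rightarrow c$ iff $a\odot b\leq c$ for all $a,b,c\in A$. $\neg a=a\rightarrow 0$, and $a^n$ is the $n$-fold $\odot$-product of $a$. A reticulation of $A$ is a pair $(\mathcal{L}(A),\lambda)$ with $\mathcal{L}(A)$ a bounded distributive lattice and $\lambda:A\to\mathcal{L}(A)$ a surjective function such that for all $a,b\in A$: $\lambda(a\odot b)=\lambda(a)\wedge\lambda(b)$; $\lambda(a\vee b)=\lambda(a)\vee\lambda(b)$; $\lambda(0)=0$, $\lambda(1)=1$; and $\lambda(a)\leq\lambda(b)$ iff $a^n\leq b$ for some integer $n\geq 1$. A reticulation exists and is unique up to isomorphism (compatible with $\lambda$). In a distributive lattice with $0$, the pseudocomplement $l^{*}$ of $l$ is the greatest element $k$ with $l\wedge k=0$, if it exists; the lattice is pseudocomplemented iff every element has a pseudocomplement. $l^{**}=(l^*)^*$. -}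

module Defs where

open import Algebra.Bundles using (CommutativeMonoid)
open import Algebra.Core using (Op₁; Op₂)
open import Algebra.Definitions using (_DistributesOverˡ_)
open import Algebra.Structures using (IsCommutativeMonoid)
import Algebra.Definitions.RawMonoid as RawMonoidDefinitions
open import Data.Nat.Base using (ℕ; _≥_)
open import Data.Product.Base using (Σ; ∃; ∃-syntax; _×_; proj₁)
open import Function.Bundles using (_⇔_)
open import Function.Definitions using (Congruent; Surjective)
open import Level using (Level; suc; _⊔_)
open import Relation.Binary.Core using (Rel)
open import Relation.Binary.Lattice.Bundles using (BoundedLattice)
open import Relation.Binary.Lattice.Definitions using (Exponential)
open import Relation.Binary.Lattice.Structures using (IsBoundedLattice)

-- As in the standard library's order-theoretic lattices, the carriers are
-- setoids, the order is part of the data, and 0, 1 are written ⊥, ⊤.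

record ResiduatedLattice c ℓ₁ ℓ₂ : Set (suc (c ⊔ ℓ₁ ⊔ ℓ₂)) where
  infix  4 _≈_ _≤_
  infixr 5 _⇨_
  infixr 6 _∨_
  infixr 7 _∧_ _⊙_
  infix  8 ¬ᴬ_
  infixr 9 _^_
  field
    Carrier             : Set c
    _≈_                 : Rel Carrier ℓ₁
    _≤_                 : Rel Carrier ℓ₂
    _∨_                 : Op₂ Carrier
    _∧_                 : Op₂ Carrier
    _⊙_                 : Op₂ Carrier
    _⇨_                 : Op₂ Carrier
    ⊤                   : Carrier
    ⊥                   : Carrier
    isBoundedLattice    : IsBoundedLattice _≈_ _≤_ _∨_ _∧_ ⊤ ⊥
    isCommutativeMonoid : IsCommutativeMonoid _≈_ _⊙_ ⊤
    -- a ⊙ b ≤ c if and only if a ≤ b ⇨ c; despite its name, the library's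
    -- Exponential does not require the operation _⊙_ to be the meet.
    residuation         : Exponential _≤_ _⊙_ _⇨_

  boundedLattice : BoundedLattice c ℓ₁ ℓ₂
  boundedLattice = record { isBoundedLattice = isBoundedLattice }

  commutativeMonoid : CommutativeMonoid c ℓ₁
  commutativeMonoid = record { isCommutativeMonoid = isCommutativeMonoid }

  open RawMonoidDefinitions (CommutativeMonoid.rawMonoid commutativeMonoid)
    using () renaming (_×_ to _times_)

  ¬ᴬ_ : Op₁ Carrier
  ¬ᴬ a = a ⇨ ⊥

  _^_ : Carrier → ℕ → Carrier
  a ^ n = n times a

  SatisfiesStoneIdentity : Set (c ⊔ ℓ₁)
  SatisfiesStoneIdentity = ∀ a → ¬ᴬ a ∨ ¬ᴬ ¬ᴬ a ≈ ⊤

record BoundedDistributiveLattice c ℓ₁ ℓ₂ : Set (suc (c ⊔ ℓ₁ ⊔ ℓ₂)) where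
  infix  4 _≈_ _≤_
  infixr 6 _∨_
  infixr 7 _∧_
  field
    Carrier          : Set c
    _≈_              : Rel Carrier ℓ₁
    _≤_              : Rel Carrier ℓ₂
    _∨_              : Op₂ Carrier
    _∧_              : Op₂ Carrier
    ⊤                : Carrier
    ⊥                : Carrier
    isBoundedLattice : IsBoundedLattice _≈_ _≤_ _∨_ _∧_ ⊤ ⊥
    ∧-distribˡ-∨     : _DistributesOverˡ_ _≈_ _∧_ _∨_

  boundedLattice : BoundedLattice c ℓ₁ ℓ₂
  boundedLattice = record { isBoundedLattice = isBoundedLattice }

  IsPseudocomplement : Carrier → Carrier → Set (c ⊔ ℓ₁ ⊔ ℓ₂)
  IsPseudocomplement l k = (l ∧ k ≈ ⊥) × (∀ m → l ∧ m ≈ ⊥ → m ≤ k)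

  Pseudocomplemented : Set (c ⊔ ℓ₁ ⊔ ℓ₂)
  Pseudocomplemented = ∀ l → ∃[ k ] IsPseudocomplement l k

  -- Pseudocomplements are unique up to _≈_, so this does not depend (up to
  -- _≈_) on the witness of pseudocomplementedness.
  pseudocomplement : Pseudocomplemented → Op₁ Carrier
  pseudocomplement pc l = proj₁ (pc l)

  IsStone : Set (c ⊔ ℓ₁ ⊔ ℓ₂)
  IsStone = Σ Pseudocomplemented λ pc →
    let _* = pseudocomplement pc in ∀ l → (l *) ∨ ((l *) *) ≈ ⊤

module _ {a ℓ₁ ℓ₂ b ℓ₃ ℓ₄ : Level}
         (A : ResiduatedLattice a ℓ₁ ℓ₂)
         (L : BoundedDistributiveLattice b ℓ₃ ℓ₄) where
  private
    module A = ResiduatedLattice A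
    module L = BoundedDistributiveLattice L

  record IsReticulation (lam : A.Carrier → L.Carrier)
         : Set (a ⊔ ℓ₁ ⊔ ℓ₂ ⊔ b ⊔ ℓ₃ ⊔ ℓ₄) where
    field
      lam-cong       : Congruent A._≈_ L._≈_ lam
      lam-surjective : Surjective A._≈_ L._≈_ lam
      lam-⊙          : ∀ x y → lam (x A.⊙ y) L.≈ lam x L.∧ lam y
      lam-∨          : ∀ x y → lam (x A.∨ y) L.≈ lam x L.∨ lam y
      lam-⊥          : lam A.⊥ L.≈ L.⊥
      lam-⊤          : lam A.⊤ L.≈ L.⊤
      lam-≤          : ∀ x y →
        lam x L.≤ lam y ⇔ (∃[ n ] (n ≥ 1) × (x A.^ n A.≤ y))

record Reticulation {a ℓ₁ ℓ₂} (A : ResiduatedLattice a ℓ₁ ℓ₂) b ℓ₃ ℓ₄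
       : Set (a ⊔ ℓ₁ ⊔ ℓ₂ ⊔ suc (b ⊔ ℓ₃ ⊔ ℓ₄)) where
  field
    lattice        : BoundedDistributiveLattice b ℓ₃ ℓ₄
    lam            : ResiduatedLattice.Carrier A →
                     BoundedDistributiveLattice.Carrier lattice
    isReticulation : IsReticulation A lattice lam

{-# OPTIONS --safe #-}

-- The counterexample is the three-element Łukasiewicz chain 0 < h < 1 with
-- h ⊙ h = 0. Here ¬ h = h, so ¬ h ∨ ¬ ¬ h = h ≠ 1. But h is nilpotent, so the
-- reticulation identifies it with 0, leaving the two-element Boolean algebra.

module Submission where

open import Algebra.Bundles using (CommutativeMonoid)
import Algebra.Construct.NaturalChoice.Max as Max
import Algebra.Construct.NaturalChoice.Min as Min
open import Algebra.Core using (Op₂)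
import Algebra.Lattice.Properties.Lattice as LatticeProperties
import Algebra.Properties.Monoid.Mult as Mult
open import Algebra.Structures using (IsCommutativeMonoid)
open import Data.Bool.Base using (Bool; true; false; not; _∨_; _∧_)
import Data.Bool.Properties as Bool
open import Data.Fin.Base using (Fin; fromℕ; _≤_)
open import Data.Fin.Patterns using (0F; 1F; 2F)
open import Data.Fin.Properties using (_≟_; _≤?_; all?; ≤-isPartialOrder; ≤-totalOrder; ≤fromℕ)
open import Data.Nat.Base using (ℕ; suc; _≥_; z≤n; s≤s)
open import Data.Product.Base using (Σ; ∃-syntax; _×_; _,_)
open import Function.Bundles using (_⇔_; mk⇔)
open import Level using (0ℓ)
open import Relation.Binary.Lattice.Definitions using (Exponential)
open import Relation.Binary.Lattice.Structures using (IsBoundedLattice)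
open import Relation.Binary.PropositionalEquality
  using (_≡_; refl; sym; trans; cong; cong₂; isEquivalence; subst)
open import Relation.Nullary using (¬_)
open import Relation.Nullary.Decidable using (from-yes; _×-dec_; _→-dec_)
open import Defs

module FinLattice (n : ℕ) where
  open Max (≤-totalOrder n) public using (_⊔_; x≤x⊔y; x≤y⊔x; ⊔-lub)
  open Min (≤-totalOrder n) public using (_⊓_; x⊓y≤x; x⊓y≤y; ⊓-glb)

Fin-isBoundedLattice : ∀ n → let open FinLattice (suc n) in
  IsBoundedLattice _≡_ _≤_ _⊔_ _⊓_ (fromℕ n) 0F
Fin-isBoundedLattice n = record
  { isLattice = record
    { isPartialOrder = ≤-isPartialOrder
    ; supremum       = λ x y → x≤x⊔y x y , x≤y⊔x x y , λ _ → ⊔-lub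
    ; infimum        = λ x y → x⊓y≤x x y , x⊓y≤y x y , λ _ → ⊓-glb
    }
  ; maximum = ≤fromℕ
  ; minimum = λ _ → z≤n
  }
  where open FinLattice (suc n)

infixr 7 _⊙_
-- With `0F`, `1F`, `2F` read as the numbers 0, 1, 2, this is the Łukasiewicz product max(0, x + y -
-- 2).
_⊙_ : Op₂ (Fin 3)
0F ⊙ _  = 0F
1F ⊙ 2F = 1F
1F ⊙ _  = 0F
2F ⊙ y  = y

infixr 5 _⇨_
-- The residuum of the Łukasiewicz product: min(2, 2 - x + y).
_⇨_ : Op₂ (Fin 3)
0F ⇨ _  = 2F
1F ⇨ 0F = 1F
1F ⇨ _  = 2F
2F ⇨ y  = y

⊙-isCommutativeMonoid : IsCommutativeMonoid _≡_ _⊙_ 2F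
⊙-isCommutativeMonoid = record
  { isMonoid = record
    { isSemigroup = record
      { isMagma = record { isEquivalence = isEquivalence ; ∙-cong = cong₂ _⊙_ }
      ; assoc   = from-yes (all? λ x → all? λ y → all? λ z → (x ⊙ y) ⊙ z ≟ x ⊙ (y ⊙ z))
      }
    ; identity = (λ _ → refl) , from-yes (all? λ x → x ⊙ 2F ≟ x)
    }
  ; comm = from-yes (all? λ x → all? λ y → x ⊙ y ≟ y ⊙ x)
  }

⊙-⇨-residuation : Exponential _≤_ _⊙_ _⇨_
⊙-⇨-residuation = from-yes (all? λ w → all? λ x → all? λ y →
  (w ⊙ x ≤? y →-dec w ≤? x ⇨ y) ×-dec (w ≤? x ⇨ y →-dec w ⊙ x ≤? y))

Ł₃ : ResiduatedLattice 0ℓ 0ℓ 0ℓ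
Ł₃ = record
  { isBoundedLattice    = Fin-isBoundedLattice 2
  ; isCommutativeMonoid = ⊙-isCommutativeMonoid
  ; residuation         = ⊙-⇨-residuation
  }

open ResiduatedLattice Ł₃ using (_^_; commutativeMonoid; SatisfiesStoneIdentity)
  renaming (_∨_ to _⊔_)

Ł₃-not-Stone : ¬ SatisfiesStoneIdentity
-- `1F` is its own negation, so this instance computes to `1F ≡ 2F`, which no constructor inhabits.
Ł₃-not-Stone stone with () ← stone 1F

𝟚 : BoundedDistributiveLattice 0ℓ 0ℓ 0ℓ
𝟚 = record
  { ⊤                = true
  ; ⊥                = false
  ; isBoundedLattice = record
    -- The order derived from the algebraic lattice is `x ≡ x ∧ y`, so every inequality in `𝟚` is a
    -- Boolean equation.
    { isLattice = LatticeProperties.∨-∧-isOrderTheoreticLattice Bool.∨-∧-lattice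
    ; maximum   = λ x → sym (Bool.∧-identityʳ x)
    ; minimum   = λ _ → refl
    }
  ; ∧-distribˡ-∨     = Bool.∧-distribˡ-∨
  }

open BoundedDistributiveLattice 𝟚 using (IsPseudocomplement; IsStone)
  renaming (_≤_ to _≤₂_)

-- In a Boolean algebra the complement is the pseudocomplement, so the Stone identity becomes
-- excluded middle.
not-isPseudocomplement : ∀ l → IsPseudocomplement l (not l)
not-isPseudocomplement l = Bool.∧-inverseʳ l , greatest l
  where
  greatest : ∀ l m → l ∧ m ≡ false → m ≤₂ not l
  greatest false m _   = sym (Bool.∧-identityʳ m)
  greatest true  m m≡⊥ = trans m≡⊥ (sym (Bool.∧-zeroʳ m))

𝟚-isStone : IsStone
𝟚-isStone = (λ l → not l , not-isPseudocomplement l) , λ l → Bool.∨-inverseʳ (not l)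

isTop : Fin 3 → Bool
isTop 2F = true
isTop _  = false

top^n≡top : ∀ {n} → n ≥ 1 → 2F ^ n ≡ 2F
-- The unit is idempotent. Matching on `n ≥ 1` exposes a successor, as `×-idem` concerns nonzero
-- exponents only.
top^n≡top (s≤s {n = n} _) = Mult.×-idem monoid {2F} refl (suc n)
  where open CommutativeMonoid commutativeMonoid using (monoid)

isTop-≤ : ∀ x y → isTop x ≤₂ isTop y ⇔ (∃[ n ] (n ≥ 1) × (x ^ n ≤ y))
-- The exponent 2 serves all pairs at once: squaring sends `1F` to `0F` and fixes the other two
-- elements.
isTop-≤ x y = mk⇔ (λ p → 2 , s≤s z≤n , square x y p) (λ (_ , n≥1 , p) → power x y n≥1 p)
  where
  square : ∀ x y → isTop x ≤₂ isTop y → x ^ 2 ≤ y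
  square = from-yes (all? λ x → all? λ y →
    (isTop x Bool.≟ isTop x ∧ isTop y) →-dec (x ^ 2 ≤? y))

  mono : ∀ x y → x ≤ y → isTop x ≤₂ isTop y
  mono = from-yes (all? λ x → all? λ y →
    (x ≤? y) →-dec (isTop x Bool.≟ isTop x ∧ isTop y))

  -- Only `2F` has an image other than `false`. Its positive powers are all `2F`, so the hypothesis
  -- becomes `2F ≤ y` and monotonicity applies.
  power : ∀ x y {n} → n ≥ 1 → x ^ n ≤ y → isTop x ≤₂ isTop y
  power 0F _ _   _ = refl
  power 1F _ _   _ = refl
  power 2F y n≥1 p = mono 2F y (subst (_≤ y) (top^n≡top n≥1) p)

isTop-isReticulation : IsReticulation Ł₃ 𝟚 isTop
isTop-isReticulation = record
  { lam-cong       = cong isTop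
  -- `Surjective` asks that everything equal to the chosen preimage has the right image, hence
  -- `cong isTop`.
  ; lam-surjective = λ where
      false → 0F , cong isTop
      true  → 2F , cong isTop
  ; lam-⊙ = from-yes (all? λ x → all? λ y → isTop (x ⊙ y) Bool.≟ isTop x ∧ isTop y)
  ; lam-∨ = from-yes (all? λ x → all? λ y → isTop (x ⊔ y) Bool.≟ isTop x ∨ isTop y)
  ; lam-⊥ = refl
  ; lam-⊤ = refl
  ; lam-≤ = isTop-≤
  }

mainTheorem7 : Σ (ResiduatedLattice 0ℓ 0ℓ 0ℓ) λ A →
    (¬ ResiduatedLattice.SatisfiesStoneIdentity A) ×
    (Σ (Reticulation A 0ℓ 0ℓ 0ℓ) λ R →
    BoundedDistributiveLattice.IsStone (Reticulation.lattice R))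
mainTheorem7 = Ł₃ , Ł₃-not-Stone , record { isReticulation = isTop-isReticulation } , 𝟚-isStone
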